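{- For all integers $m,n\ge 0$, the polynomial $$N_{m,n}(x)=\sum_{k=0}^{m}\left(\binom{m}{k}\binom{n}{k}-\binom{m}{k+1}\binom{n}{k-1}\right)x^k$$ has only real zeros.
   Context: Binomial coefficients $\binom{a}{b}$ with $a$ a nonnegative integer are $0$ when $b<0$ or $b>a$. "Has only real zeros" means that every complex zero is real (nonzero constant polynomials satisfy this vacuously). -}

module Defs where

open import Algebra.Bundles.Raw using (RawRing)
import Algebra.Definitions.RawSemiring as RawSemiringDefs
open import Data.Fin.Base using (toℕ)
open import Data.Integer.Base as ℤ using (ℤ; +_; -[1+_])
open import Data.Nat.Base as ℕ using (ℕ; suc)
import Data.Nat.Combinatorics as ℕ
import Data.Nat.Properties as ℕ
open import Data.Product.Base using (_×_; _,_; ∃-syntax)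
open import Data.Rational.Base as ℚ using (ℚ; 0ℚ; 1ℚ; ½; ∣_∣; Positive)
open import Data.Rational.Properties
open import Data.Rational.Solver using (module +-*-Solver)
open import Data.Vec.Functional using (Vector)
open import Level using (0ℓ)
open import Relation.Binary.PropositionalEquality

-- The real numbers as Cauchy sequences of rationals; equality of reals is _≃_.

IsCauchy : (ℕ → ℚ) → Set
IsCauchy f = ∀ ε → Positive ε →
  ∃[ N ] (∀ m n → N ℕ.≤ m → N ℕ.≤ n → ∣ f m ℚ.- f n ∣ ℚ.< ε)

record ℝ : Set where
  constructor mkℝ
  field
    seq    : ℕ → ℚ
    cauchy : IsCauchy seq

open ℝ public

infix 4 _≃_
_≃_ : ℝ → ℝ → Set
x ≃ y = ∀ ε → Positive ε →
  ∃[ N ] (∀ n → N ℕ.≤ n → ∣ seq x n ℚ.- seq y n ∣ ℚ.< ε)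

abstract

  const-cauchy : ∀ q → IsCauchy (λ _ → q)
  const-cauchy q ε ε>0 = 0 , λ _ _ _ _ →
    subst (λ t → ∣ t ∣ ℚ.< ε) (sym (+-inverseʳ q)) (positive⁻¹ ε {{ε>0}})

  half-pos : ∀ ε → Positive ε → Positive (½ ℚ.* ε)
  half-pos ε ε>0 = pos*pos⇒pos ½ ε {{ε>0}}

  halves : ∀ ε → ½ ℚ.* ε ℚ.+ ½ ℚ.* ε ≡ ε
  halves ε = trans (sym (*-distribʳ-+ ε ½ ½)) (*-identityˡ ε)

  +-cauchy : ∀ f g → IsCauchy f → IsCauchy g → IsCauchy (λ n → f n ℚ.+ g n)
  +-cauchy f g cf cg ε ε>0
    with M , p ← cf (½ ℚ.* ε) (half-pos ε ε>0)
       | N , q ← cg (½ ℚ.* ε) (half-pos ε ε>0)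
    = M ℕ.⊔ N , λ m n m≥ n≥ → begin-strict
      ∣ (f m ℚ.+ g m) ℚ.- (f n ℚ.+ g n) ∣
        ≡⟨ cong ∣_∣ (regroup (f m) (g m) (f n) (g n)) ⟩
      ∣ (f m ℚ.- f n) ℚ.+ (g m ℚ.- g n) ∣
        ≤⟨ ∣p+q∣≤∣p∣+∣q∣ (f m ℚ.- f n) (g m ℚ.- g n) ⟩
      ∣ f m ℚ.- f n ∣ ℚ.+ ∣ g m ℚ.- g n ∣
        <⟨ +-mono-< (p m n (ℕ.m⊔n≤o⇒m≤o M N m≥) (ℕ.m⊔n≤o⇒m≤o M N n≥))
                    (q m n (ℕ.m⊔n≤o⇒n≤o M N m≥) (ℕ.m⊔n≤o⇒n≤o M N n≥)) ⟩
      ½ ℚ.* ε ℚ.+ ½ ℚ.* ε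
        ≡⟨ halves ε ⟩
      ε ∎
    where
    open ≤-Reasoning
    open +-*-Solver
    regroup : ∀ a b c d → (a ℚ.+ b) ℚ.- (c ℚ.+ d) ≡ (a ℚ.- c) ℚ.+ (b ℚ.- d)
    regroup = solve 4 (λ a b c d →
      (a :+ b) :- (c :+ d) := (a :- c) :+ (b :- d)) refl

  neg-cauchy : ∀ f → IsCauchy f → IsCauchy (λ n → ℚ.- f n)
  neg-cauchy f cf ε ε>0 with N , p ← cf ε ε>0 = N , λ m n m≥ n≥ →
    subst (ℚ._< ε)
      (trans (sym (∣-p∣≡∣p∣ (f m ℚ.- f n)))
             (cong ∣_∣ (neg-distrib-+ (f m) (ℚ.- f n))))
      (p m n m≥ n≥)

  bounded : ∀ f → IsCauchy f →
    ∃[ B ] Positive B × ∃[ N ] (∀ n → N ℕ.≤ n → ∣ f n ∣ ℚ.≤ B)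
  bounded f cf with N , p ← cf 1ℚ _ =
      1ℚ ℚ.+ ∣ f N ∣
    , pos+nonNeg⇒pos 1ℚ ∣ f N ∣ {{∣-∣-nonNeg (f N)}}
    , N , λ n n≥ → begin
      ∣ f n ∣                       ≡⟨ cong ∣_∣ (split (f n) (f N)) ⟩
      ∣ (f n ℚ.- f N) ℚ.+ f N ∣     ≤⟨ ∣p+q∣≤∣p∣+∣q∣ (f n ℚ.- f N) (f N) ⟩
      ∣ f n ℚ.- f N ∣ ℚ.+ ∣ f N ∣   ≤⟨ +-monoˡ-≤ ∣ f N ∣ (<⇒≤ (p n N n≥ ℕ.≤-refl)) ⟩
      1ℚ ℚ.+ ∣ f N ∣                ∎
    where
    open ≤-Reasoning
    open +-*-Solver
    split : ∀ a b → a ≡ (a ℚ.- b) ℚ.+ b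
    split = solve 2 (λ a b → a := (a :- b) :+ b) refl

  tolerance : ∀ B → Positive B → ∀ ε → Positive ε →
    ∃[ δ ] Positive δ × (B ℚ.* δ ≡ ½ ℚ.* ε)
  tolerance B B>0 ε ε>0 =
      1/B ℚ.* (½ ℚ.* ε)
    , pos*pos⇒pos 1/B {{1/pos⇒pos B {{B>0}}}} (½ ℚ.* ε) {{half-pos ε ε>0}}
    , trans (sym (*-assoc B 1/B (½ ℚ.* ε)))
        (trans (cong (ℚ._* (½ ℚ.* ε)) (*-inverseʳ B {{B≢0}}))
               (*-identityˡ (½ ℚ.* ε)))
    where
    B≢0 : ℚ.NonZero B
    B≢0 = pos⇒nonZero B {{B>0}}
    1/B : ℚ
    1/B = (ℚ.1/ B) {{B≢0}}

  ∣*∣-bound : ∀ {B δ} → Positive B → ∀ p q → ∣ p ∣ ℚ.≤ B → ∣ q ∣ ℚ.< δ →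
    ∣ p ℚ.* q ∣ ℚ.< B ℚ.* δ
  ∣*∣-bound {B} {δ} B>0 p q p≤ q< = begin-strict
    ∣ p ℚ.* q ∣       ≡⟨ ∣p*q∣≡∣p∣*∣q∣ p q ⟩
    ∣ p ∣ ℚ.* ∣ q ∣   ≤⟨ *-monoʳ-≤-nonNeg ∣ q ∣ {{∣-∣-nonNeg q}} p≤ ⟩
    B ℚ.* ∣ q ∣       <⟨ *-monoʳ-<-pos B {{B>0}} q< ⟩
    B ℚ.* δ           ∎
    where open ≤-Reasoning

  ∣ab-cd∣-bound : ∀ {A α B β} → Positive A → Positive B → ∀ a b c d →
    ∣ a ∣ ℚ.≤ A → ∣ b ℚ.- d ∣ ℚ.< α → ∣ d ∣ ℚ.≤ B → ∣ a ℚ.- c ∣ ℚ.< β →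
    ∣ a ℚ.* b ℚ.- c ℚ.* d ∣ ℚ.< A ℚ.* α ℚ.+ B ℚ.* β
  ∣ab-cd∣-bound {A} {α} {B} {β} A>0 B>0 a b c d a≤ b-d< d≤ a-c< = begin-strict
    ∣ a ℚ.* b ℚ.- c ℚ.* d ∣
      ≡⟨ cong ∣_∣ (regroup a b c d) ⟩
    ∣ a ℚ.* (b ℚ.- d) ℚ.+ d ℚ.* (a ℚ.- c) ∣
      ≤⟨ ∣p+q∣≤∣p∣+∣q∣ (a ℚ.* (b ℚ.- d)) (d ℚ.* (a ℚ.- c)) ⟩
    ∣ a ℚ.* (b ℚ.- d) ∣ ℚ.+ ∣ d ℚ.* (a ℚ.- c) ∣
      <⟨ +-mono-< (∣*∣-bound A>0 a (b ℚ.- d) a≤ b-d<)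
                  (∣*∣-bound B>0 d (a ℚ.- c) d≤ a-c<) ⟩
    A ℚ.* α ℚ.+ B ℚ.* β ∎
    where
    open ≤-Reasoning
    open +-*-Solver
    regroup : ∀ a b c d →
      a ℚ.* b ℚ.- c ℚ.* d ≡ a ℚ.* (b ℚ.- d) ℚ.+ d ℚ.* (a ℚ.- c)
    regroup = solve 4 (λ a b c d →
      a :* b :- c :* d := a :* (b :- d) :+ d :* (a :- c)) refl

  *-cauchy : ∀ f g → IsCauchy f → IsCauchy g → IsCauchy (λ n → f n ℚ.* g n)
  *-cauchy f g cf cg ε ε>0 =
    let A , A>0 , K , f≤A = bounded f cf
        B , B>0 , L , g≤B = bounded g cg
        α , α>0 , Aα≡ = tolerance A A>0 ε ε>0
        β , β>0 , Bβ≡ = tolerance B B>0 ε ε>0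
        M , p = cg α α>0
        N , q = cf β β>0
    in (K ℕ.⊔ L) ℕ.⊔ (M ℕ.⊔ N) , λ m n m≥ n≥ →
      let m≥KL = ℕ.m⊔n≤o⇒m≤o (K ℕ.⊔ L) (M ℕ.⊔ N) m≥
          n≥KL = ℕ.m⊔n≤o⇒m≤o (K ℕ.⊔ L) (M ℕ.⊔ N) n≥
          m≥MN = ℕ.m⊔n≤o⇒n≤o (K ℕ.⊔ L) (M ℕ.⊔ N) m≥
          n≥MN = ℕ.m⊔n≤o⇒n≤o (K ℕ.⊔ L) (M ℕ.⊔ N) n≥
      in subst (∣ f m ℚ.* g m ℚ.- f n ℚ.* g n ∣ ℚ.<_)
           (trans (cong₂ ℚ._+_ Aα≡ Bβ≡) (halves ε))
           (∣ab-cd∣-bound A>0 B>0 (f m) (g m) (f n) (g n)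
             (f≤A m (ℕ.m⊔n≤o⇒m≤o K L m≥KL))
             (p m n (ℕ.m⊔n≤o⇒m≤o M N m≥MN) (ℕ.m⊔n≤o⇒m≤o M N n≥MN))
             (g≤B n (ℕ.m⊔n≤o⇒n≤o K L n≥KL))
             (q m n (ℕ.m⊔n≤o⇒n≤o M N m≥MN) (ℕ.m⊔n≤o⇒n≤o M N n≥MN)))

fromℚ : ℚ → ℝ
fromℚ q = mkℝ (λ _ → q) (const-cauchy q)

fromℤ : ℤ → ℝ
fromℤ i = fromℚ (i ℚ./ 1)

infixl 6 _+ᵣ_ _-ᵣ_
infixl 7 _*ᵣ_
infix  8 -ᵣ_

_+ᵣ_ : ℝ → ℝ → ℝ
mkℝ f cf +ᵣ mkℝ g cg = mkℝ (λ n → f n ℚ.+ g n) (+-cauchy f g cf cg)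

_*ᵣ_ : ℝ → ℝ → ℝ
mkℝ f cf *ᵣ mkℝ g cg = mkℝ (λ n → f n ℚ.* g n) (*-cauchy f g cf cg)

-ᵣ_ : ℝ → ℝ
-ᵣ mkℝ f cf = mkℝ (λ n → ℚ.- f n) (neg-cauchy f cf)

_-ᵣ_ : ℝ → ℝ → ℝ
x -ᵣ y = x +ᵣ (-ᵣ y)

0ᵣ 1ᵣ : ℝ
0ᵣ = fromℚ 0ℚ
1ᵣ = fromℚ 1ℚ

record ℂ : Set where
  constructor _+i_
  field
    Re : ℝ
    Im : ℝ

open ℂ public

ℂ-rawRing : RawRing 0ℓ 0ℓ
ℂ-rawRing = record
  { Carrier = ℂ
  ; _≈_     = λ w z → (Re w ≃ Re z) × (Im w ≃ Im z)
  ; _+_     = λ w z → (Re w +ᵣ Re z) +i (Im w +ᵣ Im z)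
  ; _*_     = λ w z → (Re w *ᵣ Re z -ᵣ Im w *ᵣ Im z)
                   +i (Re w *ᵣ Im z +ᵣ Im w *ᵣ Re z)
  ; -_      = λ z → (-ᵣ Re z) +i (-ᵣ Im z)
  ; 0#      = 0ᵣ +i 0ᵣ
  ; 1#      = 1ᵣ +i 0ᵣ
  }

open RawRing ℂ-rawRing public using () renaming
  (_≈_ to _≈ᶜ_; _+_ to _+ᶜ_; _*_ to _*ᶜ_; -_ to -ᶜ_; 0# to 0ᶜ; 1# to 1ᶜ)
open RawSemiringDefs (RawRing.rawSemiring ℂ-rawRing) public using () renaming
  (sum to sumᶜ; _^_ to _^ᶜ_)

fromℝ : ℝ → ℂ
fromℝ x = x +i 0ᵣ

-- A real polynomial, given by its coefficients of x⁰, …, xᵈ⁻¹; leading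
-- coefficients may vanish.
Polynomial : ℕ → Set
Polynomial d = Vector ℝ d

eval : ∀ {d} → Polynomial d → ℂ → ℂ
eval p z = sumᶜ λ k → fromℝ (p k) *ᶜ (z ^ᶜ toℕ k)

IsReal : ℂ → Set
IsReal z = Im z ≃ 0ᵣ

HasOnlyRealZeros : ∀ {d} → Polynomial d → Set
HasOnlyRealZeros p = ∀ z → eval p z ≈ᶜ 0ᶜ → IsReal z

-- The library's a C b is 0 for b > a; the lower index is an integer here
-- because k - 1 is negative at k = 0.
binomial : ℕ → ℤ → ℤ
binomial a (+ b)    = + (a ℕ.C b)
binomial a -[1+ _ ] = + 0

coefficient : ℕ → ℕ → ℤ → ℤ
coefficient m n k =
  binomial m k ℤ.* binomial n k
    ℤ.- binomial m (k ℤ.+ + 1) ℤ.* binomial n (k ℤ.- + 1)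

N[_,_] : (m n : ℕ) → Polynomial (suc m)
N[ m , n ] k = fromℤ (coefficient m n (+ toℕ k))

-- Let S = Σₖ m! (n+1)! / ((m-k)! (n+1-k)! k! (k+1)!) xᵏ and let θ = x d/dx.
-- Then (n+1) N[ m , n ] = (n+1) S + (n-m) θS, so Im (θS(z) · conj N(z)) equals
-- Im (θS(z) · conj S(z)) for every z, and it suffices that the latter is nonzero
-- off the real axis.  Up to a factor θS = X and S is a multiple of X plus Y, where
-- X = z F and Y = G for a pair F, G of polynomials of the same type.  For such
-- pairs Im (z F · conj G) > 0 and Im (G · conj F) ≥ 0 in the upper half plane, by
-- induction on the degree: contiguous relations express the next pair as
-- F' = ρ X + Y and G' = δ X + κ F' with ρ, δ, κ ≥ 1, whence
--   Im (z F' · conj G') = Im z · (κ |F'|² + δ ρ |X|²) + δ |z|² Im (G · conj F).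
-- All estimates are made over ℚ[i], uniformly in z, and applied to the terms of
-- the Cauchy sequences; a sign s = ±1 treats both half planes at once.

module Submission where

open import Defs
open import Data.Empty using (⊥-elim)
open import Data.Fin.Base using (toℕ)
open import Data.Integer.Base as ℤ using (+_)
import Data.Integer.Properties as ℤ
open import Data.Nat.Base as ℕ using (ℕ; zero; suc; z≤n; s≤s)
import Data.Nat.Combinatorics as ℕ
import Data.Nat.Properties as ℕ
open import Data.Product.Base using (_×_; _,_; ∃-syntax; proj₁)
open import Data.Rational.Base hiding (_≃_)
open import Data.Rational.Properties
open import Data.Rational.Solver using (module +-*-Solver)
import Data.Rational.Unnormalised.Base as ℚᵘ
import Data.Rational.Unnormalised.Properties as ℚᵘ
open import Data.Sum.Base using (inj₁; inj₂)
open import Function.Base using (_∘_)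
open import Relation.Binary.PropositionalEquality
open import Relation.Nullary using (¬_)
open +-*-Solver using (solve; con; _:+_; _:*_; _:-_; :-_; _:=_)

-- Order and sign facts in ℚ.

≤-by-difference : ∀ {p q} d → 0ℚ ≤ d → p + d ≡ q → p ≤ q
≤-by-difference {p} d 0≤d refl =
  subst (_≤ p + d) (+-identityʳ p) (+-monoʳ-≤ p 0≤d)

+-nonNeg : ∀ {p q} → 0ℚ ≤ p → 0ℚ ≤ q → 0ℚ ≤ p + q
+-nonNeg = +-mono-≤

*-nonNeg : ∀ {p q} → 0ℚ ≤ p → 0ℚ ≤ q → 0ℚ ≤ p * q
*-nonNeg {p} {q} 0≤p 0≤q =
  subst (_≤ p * q) (*-zeroʳ p) (*-monoˡ-≤-nonNeg p {{nonNegative 0≤p}} 0≤q)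

*-mono-≤-nonNeg : ∀ {p q r s} → 0ℚ ≤ p → 0ℚ ≤ r → p ≤ q → r ≤ s → p * r ≤ q * s
*-mono-≤-nonNeg {p} {q} {r} {s} 0≤p 0≤r p≤q r≤s = ≤-trans
  (*-monoʳ-≤-nonNeg r {{nonNegative 0≤r}} p≤q)
  (*-monoˡ-≤-nonNeg q {{nonNegative (≤-trans 0≤p p≤q)}} r≤s)

0≤1 : 0ℚ ≤ 1ℚ
0≤1 = nonNegative⁻¹ 1ℚ

square-nonNeg : ∀ p → 0ℚ ≤ p * p
square-nonNeg p with ∣p∣≡p∨∣p∣≡-p p
... | inj₁ eq = *-nonNeg 0≤p 0≤p
  where
  0≤p : 0ℚ ≤ p
  0≤p = subst (0ℚ ≤_) eq (0≤∣p∣ p)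
... | inj₂ eq = subst (0ℚ ≤_) (lemma p) (*-nonNeg 0≤-p 0≤-p)
  where
  0≤-p : 0ℚ ≤ - p
  0≤-p = subst (0ℚ ≤_) eq (0≤∣p∣ p)
  lemma : ∀ p → - p * - p ≡ p * p
  lemma = solve 1 (λ p → :- p :* :- p := p :* p) refl

*-cancelˡ-pos : ∀ q → Positive q → ∀ {x y} → q * x ≡ q * y → x ≡ y
*-cancelˡ-pos q q>0 eq = ≤-antisym
  (*-cancelˡ-≤-pos q {{q>0}} (≤-reflexive eq))
  (*-cancelˡ-≤-pos q {{q>0}} (≤-reflexive (sym eq)))

p≤∣p∣ : ∀ p → p ≤ ∣ p ∣
p≤∣p∣ p with ∣p∣≡p∨∣p∣≡-p p
... | inj₁ eq = ≤-reflexive (sym eq)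
-- Here `∣ p ∣` is `- p`, so `p` falls short of `∣ p ∣` by exactly twice `∣ p ∣`.
... | inj₂ eq = ≤-by-difference (∣ p ∣ + ∣ p ∣) (+-nonNeg (0≤∣p∣ p) (0≤∣p∣ p))
  (trans (cong (λ q → p + (q + ∣ p ∣)) eq) (cancel p ∣ p ∣))
  where
  cancel : ∀ p q → p + (- p + q) ≡ q
  cancel = solve 2 (λ p q → p :+ (:- p :+ q) := q) refl

-- Integers and naturals inside ℚ.

/1-+ : ∀ i j → (i ℤ.+ j) / 1 ≡ i / 1 + j / 1
/1-+ i j = toℚᵘ-injective (begin
  toℚᵘ ((i ℤ.+ j) / 1)                    ≈⟨ toℚᵘ-fromℚᵘ (ℚᵘ.mkℚᵘ (i ℤ.+ j) 0) ⟩
  -- Unnormalised addition multiplies each numerator by the other denominator, here 1.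
  ℚᵘ.mkℚᵘ (i ℤ.+ j) 0                     ≈⟨ ℚᵘ.≃-reflexive (cong₂ (λ a b → ℚᵘ.mkℚᵘ (a ℤ.+ b) 0) (sym (ℤ.*-identityʳ i)) (sym (ℤ.*-identityʳ j))) ⟩
  ℚᵘ.mkℚᵘ i 0 ℚᵘ.+ ℚᵘ.mkℚᵘ j 0            ≈⟨ ℚᵘ.+-cong (toℚᵘ-fromℚᵘ (ℚᵘ.mkℚᵘ i 0)) (toℚᵘ-fromℚᵘ (ℚᵘ.mkℚᵘ j 0)) ⟨
  toℚᵘ (i / 1) ℚᵘ.+ toℚᵘ (j / 1)          ≈⟨ toℚᵘ-homo-+ (i / 1) (j / 1) ⟨
  toℚᵘ (i / 1 + j / 1)                    ∎)
  where open ℚᵘ.≃-Reasoning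

/1-* : ∀ i j → (i ℤ.* j) / 1 ≡ i / 1 * (j / 1)
/1-* i j = toℚᵘ-injective (begin
  toℚᵘ ((i ℤ.* j) / 1)                    ≈⟨ toℚᵘ-fromℚᵘ (ℚᵘ.mkℚᵘ (i ℤ.* j) 0) ⟩
  ℚᵘ.mkℚᵘ i 0 ℚᵘ.* ℚᵘ.mkℚᵘ j 0            ≈⟨ ℚᵘ.*-cong (toℚᵘ-fromℚᵘ (ℚᵘ.mkℚᵘ i 0)) (toℚᵘ-fromℚᵘ (ℚᵘ.mkℚᵘ j 0)) ⟨
  toℚᵘ (i / 1) ℚᵘ.* toℚᵘ (j / 1)          ≈⟨ toℚᵘ-homo-* (i / 1) (j / 1) ⟨
  toℚᵘ (i / 1 * (j / 1))                  ∎)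
  where open ℚᵘ.≃-Reasoning

/1-neg : ∀ i → (ℤ.- i) / 1 ≡ - (i / 1)
/1-neg i = begin
  (ℤ.- i) / 1                        ≡⟨ shift ((ℤ.- i) / 1) (i / 1) ⟩
  ((ℤ.- i) / 1 + i / 1) - i / 1      ≡⟨ cong (_- i / 1) (/1-+ (ℤ.- i) i) ⟨
  ((ℤ.- i ℤ.+ i) / 1) - i / 1        ≡⟨ cong (λ j → j / 1 - i / 1) (ℤ.+-inverseˡ i) ⟩
  0ℚ - i / 1                         ≡⟨ +-identityˡ (- (i / 1)) ⟩
  - (i / 1)                          ∎
  where
  open ≡-Reasoning
  shift : ∀ p q → p ≡ (p + q) - q
  shift = solve 2 (λ p q → p := (p :+ q) :- q) refl

-- Recursive, so that `ι (suc n)` unfolds to `1ℚ + ι n` and the ring solver can treat `ι n` as a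
-- variable.
ι : ℕ → ℚ
ι zero    = 0ℚ
ι (suc n) = 1ℚ + ι n

/1≡ι : ∀ n → (+ n) / 1 ≡ ι n
/1≡ι zero    = refl
/1≡ι (suc n) = trans (/1-+ (+ 1) (+ n)) (cong (_+_ 1ℚ) (/1≡ι n))

0≤ι : ∀ n → 0ℚ ≤ ι n
0≤ι zero    = ≤-refl
0≤ι (suc n) = +-nonNeg 0≤1 (0≤ι n)

1≤ι-suc : ∀ n → 1ℚ ≤ ι (suc n)
1≤ι-suc n = ≤-by-difference (ι n) (0≤ι n) refl

ι-suc-positive : ∀ n → Positive (ι (suc n))
ι-suc-positive n = positive (<-≤-trans (positive⁻¹ 1ℚ) (1≤ι-suc n))

ι-suc-nonZero : ∀ n → NonZero (ι (suc n))
ι-suc-nonZero n = pos⇒nonZero (ι (suc n)) {{ι-suc-positive n}}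

ι-mono-≤ : ∀ {m n} → m ℕ.≤ n → ι m ≤ ι n
ι-mono-≤ {n = n} z≤n = 0≤ι n
ι-mono-≤ (s≤s m≤n)  = +-monoʳ-≤ 1ℚ (ι-mono-≤ m≤n)

-- Falling factorials, reciprocal factorials and binomial coefficients.

falling : ℕ → ℕ → ℚ
falling _       zero    = 1ℚ
falling zero    (suc _) = 0ℚ
falling (suc n) (suc k) = ι (suc n) * falling n k

-- The definition splits off the first factor n, this splits off the last one, n - k. Subtraction in
-- ℚ is not truncated, but for k ≥ n both sides vanish.
falling-suc : ∀ n k → falling n (suc k) ≡ (ι n - ι k) * falling n k
falling-suc zero    zero    = refl
falling-suc zero    (suc k) = sym (*-zeroʳ (0ℚ - ι (suc k)))
falling-suc (suc n) zero    = base (ι n)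
  where
  base : ∀ n → (1ℚ + n) * 1ℚ ≡ ((1ℚ + n) - 0ℚ) * 1ℚ
  base = solve 1 (λ n → (con 1ℚ :+ n) :* con 1ℚ
                     := ((con 1ℚ :+ n) :- con 0ℚ) :* con 1ℚ) refl
falling-suc (suc n) (suc k) rewrite falling-suc n k = step (ι n) (ι k) (falling n k)
  where
  step : ∀ n k p → (1ℚ + n) * ((n - k) * p) ≡ ((1ℚ + n) - (1ℚ + k)) * ((1ℚ + n) * p)
  step = solve 3 (λ n k p → (con 1ℚ :+ n) :* ((n :- k) :* p)
                         := ((con 1ℚ :+ n) :- (con 1ℚ :+ k)) :* ((con 1ℚ :+ n) :* p)) refl

falling-vanishes : ∀ {n k} → n ℕ.< k → falling n k ≡ 0ℚ
falling-vanishes {zero}  {suc k} _         = refl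
falling-vanishes {suc n} {suc k} (s≤s n<k) =
  trans (cong (ι (suc n) *_) (falling-vanishes n<k)) (*-zeroʳ (ι (suc n)))

1/_! : ℕ → ℚ
1/ zero  ! = 1ℚ
1/ suc n ! = (1/ ι (suc n)) {{ι-suc-nonZero n}} * 1/ n !

1/!-suc : ∀ n → 1/ n ! ≡ ι (suc n) * 1/ suc n !
1/!-suc n = sym (begin
  ι (suc n) * (1/ι * 1/ n !)  ≡⟨ *-assoc (ι (suc n)) 1/ι (1/ n !) ⟨
  ι (suc n) * 1/ι * 1/ n !    ≡⟨ cong (_* 1/ n !) (*-inverseʳ (ι (suc n)) {{ι-suc-nonZero n}}) ⟩
  1ℚ * 1/ n !                 ≡⟨ *-identityˡ (1/ n !) ⟩
  1/ n !                      ∎)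
  where
  open ≡-Reasoning
  1/ι = (1/ ι (suc n)) {{ι-suc-nonZero n}}

1/!-positive : ∀ n → Positive (1/ n !)
1/!-positive zero    = _
1/!-positive (suc n) = pos*pos⇒pos
  ((1/ ι (suc n)) {{ι-suc-nonZero n}}) {{1/pos⇒pos (ι (suc n)) {{ι-suc-positive n}}}}
  (1/ n !) {{1/!-positive n}}

-- 1/[ j + k ]! is 1/(j+k)!, by recursion on k so that increasing j and k
-- by one in either order gives the same term.
1/[_+_]! : ℕ → ℕ → ℚ
1/[ j + zero  ]! = 1/ j !
1/[ j + suc k ]! = 1/[ suc j + k ]!

1/[+]!-suc : ∀ j k → 1/[ j + k ]! ≡ (ι (suc j) + ι k) * 1/[ suc j + k ]!
1/[+]!-suc j zero    = trans (1/!-suc j)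
  (cong (_* 1/ suc j !) (sym (+-identityʳ (ι (suc j)))))
1/[+]!-suc j (suc k) = trans (1/[+]!-suc (suc j) k)
  (cong (_* 1/[ suc (suc j) + k ]!) (regroup (ι (suc j)) (ι k)))
  where
  regroup : ∀ j k → (1ℚ + j) + k ≡ j + (1ℚ + k)
  regroup = solve 2 (λ j k → (con 1ℚ :+ j) :+ k := j :+ (con 1ℚ :+ k)) refl

-- Both sides obey Pascal's rule: over the common factor `falling n k * 1/[ 1 + k ]!` it reads (k+1)
-- + (n-k) = n+1.
C≡falling : ∀ n k → (+ (n ℕ.C k)) / 1 ≡ falling n k * 1/[ 0 + k ]!
C≡falling n zero = cong (λ c → (+ c) / 1)
  (trans (ℕ.nCk≡nC[n∸k] {0} {n} z≤n) (ℕ.nCn≡1 n))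
C≡falling zero (suc k) = trans (cong (λ c → (+ c) / 1) (ℕ.k>n⇒nCk≡0 {0} {suc k} (s≤s z≤n)))
  (sym (*-zeroˡ 1/[ 1 + k ]!))
C≡falling (suc n) (suc k) = begin
  (+ (suc n ℕ.C suc k)) / 1
    ≡⟨ cong (λ c → (+ c) / 1) {suc n ℕ.C suc k} {n ℕ.C k ℕ.+ n ℕ.C suc k} (sym (ℕ.nCk+nC[k+1]≡[n+1]C[k+1] n k)) ⟩
  (+ (n ℕ.C k ℕ.+ n ℕ.C suc k)) / 1
    ≡⟨ /1-+ (+ (n ℕ.C k)) (+ (n ℕ.C suc k)) ⟩
  (+ (n ℕ.C k)) / 1 + (+ (n ℕ.C suc k)) / 1
    ≡⟨ cong₂ _+_ (C≡falling n k) (C≡falling n (suc k)) ⟩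
  falling n k * 1/[ 0 + k ]! + falling n (suc k) * 1/[ 1 + k ]!
    ≡⟨ cong₂ (λ p q → falling n k * p + q * 1/[ 1 + k ]!) (1/[+]!-suc 0 k) (falling-suc n k) ⟩
  falling n k * ((ι 1 + ι k) * 1/[ 1 + k ]!) + (ι n - ι k) * falling n k * 1/[ 1 + k ]!
    ≡⟨ pascal (ι n) (ι k) (falling n k) 1/[ 1 + k ]! ⟩
  ι (suc n) * falling n k * 1/[ 1 + k ]! ∎
  where
  open ≡-Reasoning
  pascal : ∀ n k p r →
    p * (((1ℚ + 0ℚ) + k) * r) + (n - k) * p * r ≡ (1ℚ + n) * p * r
  pascal = solve 4 (λ n k p r →
    p :* (((con 1ℚ :+ con 0ℚ) :+ k) :* r) :+ (n :- k) :* p :* r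
      := (con 1ℚ :+ n) :* p :* r) refl

-- Contiguous relations for the Jacobi-type coefficients.

-- coeff j m n is the coefficient sequence of the Jacobi-type polynomial
-- Σₖ m! n! / ((m-k)! (n-k)! k! (k+j)!) xᵏ.
coeff : ℕ → ℕ → ℕ → ℕ → ℚ
coeff j m n k = falling m k * falling n k * (1/[ 0 + k ]! * 1/[ j + k ]!)

coeff-comm : ∀ j m n k → coeff j m n k ≡ coeff j n m k
coeff-comm j m n k = cong (_* (1/[ 0 + k ]! * 1/[ j + k ]!)) (*-comm (falling m k) (falling n k))

coeff-vanishes : ∀ j {m} n {k} → m ℕ.< k → coeff j m n k ≡ 0ℚ
coeff-vanishes j {m} n {k} m<k = begin
  falling m k * falling n k * r ≡⟨ cong (λ p → p * falling n k * r) (falling-vanishes m<k) ⟩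
  0ℚ * falling n k * r          ≡⟨ cong (_* r) (*-zeroˡ (falling n k)) ⟩
  0ℚ * r                        ≡⟨ *-zeroˡ r ⟩
  0ℚ                            ∎
  where
  open ≡-Reasoning
  r = 1/[ 0 + k ]! * 1/[ j + k ]!

coeff₀-positive : ∀ j m n → Positive (coeff j m n 0)
coeff₀-positive j m n = subst Positive (sym (trans (*-identityˡ (1ℚ * 1/ j !)) (*-identityˡ (1/ j !)))) (1/!-positive j)

-- After removal of common factors this is (m+1)(n-k) = (n-m)(k+1) + (m-k)(n+1). It provides F' = ρ
-- X + Y with ρ = n - m.
coeff-raise₁ : ∀ j m n k → coeff j (suc m) n (suc k) ≡
  (ι n - ι m) * coeff (suc j) m n k + 1ℚ * coeff j m (suc n) (suc k)
coeff-raise₁ j m n k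
  rewrite falling-suc m k | falling-suc n k | 1/[+]!-suc 0 k
  = identity (ι m) (ι n) (ι k) (falling m k) (falling n k) 1/[ 1 + k ]! 1/[ suc j + k ]!
  where
  identity : ∀ m n k p q r t →
    (1ℚ + m) * p * ((n - k) * q) * (r * t) ≡
    (n - m) * (p * q * (((1ℚ + 0ℚ) + k) * r * t)) + 1ℚ * ((m - k) * p * ((1ℚ + n) * q) * (r * t))
  identity = solve 7 (λ m n k p q r t →
    (con 1ℚ :+ m) :* p :* ((n :- k) :* q) :* (r :* t) :=
    (n :- m) :* (p :* q :* (((con 1ℚ :+ con 0ℚ) :+ k) :* r :* t)) :+ con 1ℚ :* ((m :- k) :* p :* ((con 1ℚ :+ n) :* q) :* (r :* t))) refl

-- After removal of common factors this is (n+1)(j+2+k) = (n+j+2)(k+1) + (j+1)(n-k). It provides G'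
-- = δ X + κ F'.
coeff-lower : ∀ j m n k → coeff j (suc m) (suc n) (suc k) ≡
  ι (suc m) * (ι (suc n) + ι (suc j)) * coeff (suc (suc j)) m n k +
  ι (suc j) * coeff (suc j) (suc m) n (suc k)
coeff-lower j m n k
  rewrite falling-suc n k | 1/[+]!-suc 0 k | 1/[+]!-suc (suc j) k
  = identity (ι j) (ι m) (ι n) (ι k) (falling m k) (falling n k) 1/[ 1 + k ]! 1/[ suc (suc j) + k ]!
  where
  identity : ∀ j m n k p q r t →
    (1ℚ + m) * p * ((1ℚ + n) * q) * (r * (((1ℚ + (1ℚ + j)) + k) * t)) ≡
    (1ℚ + m) * ((1ℚ + n) + (1ℚ + j)) * (p * q * (((1ℚ + 0ℚ) + k) * r * t)) +
    (1ℚ + j) * ((1ℚ + m) * p * ((n - k) * q) * (r * t))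
  identity = solve 8 (λ j m n k p q r t →
    (con 1ℚ :+ m) :* p :* ((con 1ℚ :+ n) :* q) :* (r :* (((con 1ℚ :+ (con 1ℚ :+ j)) :+ k) :* t)) :=
    (con 1ℚ :+ m) :* ((con 1ℚ :+ n) :+ (con 1ℚ :+ j)) :* (p :* q :* (((con 1ℚ :+ con 0ℚ) :+ k) :* r :* t)) :+
    (con 1ℚ :+ j) :* ((con 1ℚ :+ m) :* p :* ((n :- k) :* q) :* (r :* t))) refl

coeff-lower₀ : ∀ j m n → coeff j (suc m) (suc n) 0 ≡ ι (suc j) * coeff (suc j) (suc m) n 0
coeff-lower₀ j m n = trans (cong (λ r → 1ℚ * 1ℚ * (1ℚ * r)) (1/!-suc j))
  (identity (ι (suc j)) 1/ suc j !)
  where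
  identity : ∀ i r → 1ℚ * 1ℚ * (1ℚ * (i * r)) ≡ i * (1ℚ * 1ℚ * (1ℚ * r))
  identity = solve 2 (λ i r → con 1ℚ :* con 1ℚ :* (con 1ℚ :* (i :* r)) :=
    i :* (con 1ℚ :* con 1ℚ :* (con 1ℚ :* r))) refl

-- Rests on m+1 = (k+1) + (m-k). With j = 1 it writes S as a multiple of X plus Y.
coeff-raise₂ : ∀ j m n k → coeff j (suc m) (suc n) (suc k) ≡
  ι (suc n) * coeff (suc j) m n k + 1ℚ * coeff j m (suc n) (suc k)
coeff-raise₂ j m n k
  rewrite falling-suc m k | 1/[+]!-suc 0 k
  = identity (ι m) (ι n) (ι k) (falling m k) (falling n k) 1/[ 1 + k ]! 1/[ suc j + k ]!
  where
  identity : ∀ m n k p q r t →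
    (1ℚ + m) * p * ((1ℚ + n) * q) * (r * t) ≡
    (1ℚ + n) * (p * q * (((1ℚ + 0ℚ) + k) * r * t)) + 1ℚ * ((m - k) * p * ((1ℚ + n) * q) * (r * t))
  identity = solve 7 (λ m n k p q r t →
    (con 1ℚ :+ m) :* p :* ((con 1ℚ :+ n) :* q) :* (r :* t) :=
    (con 1ℚ :+ n) :* (p :* q :* (((con 1ℚ :+ con 0ℚ) :+ k) :* r :* t)) :+ con 1ℚ :* ((m :- k) :* p :* ((con 1ℚ :+ n) :* q) :* (r :* t))) refl

-- The coefficients of N in terms of S and θS.

/1-*-minus-* : ∀ a b c d → (a ℤ.* b ℤ.- c ℤ.* d) / 1 ≡ a / 1 * (b / 1) - c / 1 * (d / 1)
/1-*-minus-* a b c d = trans (/1-+ (a ℤ.* b) (ℤ.- (c ℤ.* d)))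
  (cong₂ _+_ (/1-* a b) (trans (/1-neg (c ℤ.* d)) (cong -_ (/1-* c d))))

coefficient₀ : ∀ m n → coefficient m n (+ 0) / 1 ≡ 1ℚ
coefficient₀ m n = begin
  coefficient m n (+ 0) / 1
    -- The last argument `+ 0` is the binomial coefficient with lower index -1.
    ≡⟨ /1-*-minus-* (binomial m (+ 0)) (binomial n (+ 0)) (binomial m (+ 1)) (+ 0) ⟩
  binomial m (+ 0) / 1 * (binomial n (+ 0) / 1) - binomial m (+ 1) / 1 * 0ℚ
    ≡⟨ cong₂ _-_ (cong₂ _*_ (C≡falling m 0) (C≡falling n 0)) (*-zeroʳ (binomial m (+ 1) / 1)) ⟩
  1ℚ ∎
  where open ≡-Reasoning

coefficient-falling : ∀ m n k → coefficient m n (+ suc k) / 1 ≡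
  falling m (suc k) * 1/[ 1 + k ]! * (falling n (suc k) * 1/[ 1 + k ]!) -
  falling m (suc (suc k)) * 1/[ 2 + k ]! * (falling n k * 1/[ 0 + k ]!)
coefficient-falling m n k = begin
  coefficient m n (+ suc k) / 1
    ≡⟨ /1-*-minus-* (binomial m (+ suc k)) (binomial n (+ suc k)) (binomial m (+ suc (k ℕ.+ 1))) (binomial n (+ k)) ⟩
  binomial m (+ suc k) / 1 * (binomial n (+ suc k) / 1) - binomial m (+ suc (k ℕ.+ 1)) / 1 * (binomial n (+ k) / 1)
    ≡⟨ cong₂ _-_
         (cong₂ _*_ (C≡falling m (suc k)) (C≡falling n (suc k)))
         (cong₂ _*_ (trans (C≡falling m (suc (k ℕ.+ 1))) (cong (λ i → falling m (suc i) * 1/[ 1 + i ]!) (ℕ.+-comm k 1)))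
                    (C≡falling n k)) ⟩
  falling m (suc k) * 1/[ 1 + k ]! * (falling n (suc k) * 1/[ 1 + k ]!) -
  falling m (suc (suc k)) * 1/[ 2 + k ]! * (falling n k * 1/[ 0 + k ]!) ∎
  where open ≡-Reasoning

-- The relation (n+1) N = (n+1) S + (n-m) θS with m replaced by m+1, at index k+1; there θS has the
-- coefficient (m+1)(n+1) `coeff 2 m n k`. Over common factors it is (k+2)(n-k) - (m-k)(k+1) =
-- (n-m-1)(k+1) + (n+1).
coefficient-suc : ∀ m n k →
  ι (suc n) * (coefficient (suc m) n (+ suc k) / 1) ≡
  (ι n - ι (suc m)) * (ι (suc m) * ι (suc n)) * coeff 2 m n k +
  ι (suc n) * coeff 1 (suc m) (suc n) (suc k)
coefficient-suc m n k = trans (cong (ι (suc n) *_) (coefficient-falling (suc m) n k)) falling-identity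
  where
  falling-identity :
    ι (suc n) * (falling (suc m) (suc k) * 1/[ 1 + k ]! * (falling n (suc k) * 1/[ 1 + k ]!) -
                 falling (suc m) (suc (suc k)) * 1/[ 2 + k ]! * (falling n k * 1/[ 0 + k ]!)) ≡
    (ι n - ι (suc m)) * (ι (suc m) * ι (suc n)) * coeff 2 m n k +
    ι (suc n) * coeff 1 (suc m) (suc n) (suc k)
  falling-identity
    rewrite falling-suc m k | falling-suc n k | 1/[+]!-suc 0 k | 1/[+]!-suc 1 k
    = identity (ι m) (ι n) (ι k) (falling m k) (falling n k) 1/[ 2 + k ]!
    where
    identity : ∀ m n k p q t → let r = ((1ℚ + (1ℚ + 0ℚ)) + k) * t in
      (1ℚ + n) * ((1ℚ + m) * p * r * ((n - k) * q * r) -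
                  (1ℚ + m) * ((m - k) * p) * t * (q * (((1ℚ + 0ℚ) + k) * r))) ≡
      (n - (1ℚ + m)) * ((1ℚ + m) * (1ℚ + n)) * (p * q * (((1ℚ + 0ℚ) + k) * r * t)) +
      (1ℚ + n) * ((1ℚ + m) * p * ((1ℚ + n) * q) * (r * t))
    identity = solve 6 (λ m n k p q t → let r = ((con 1ℚ :+ (con 1ℚ :+ con 0ℚ)) :+ k) :* t in
      (con 1ℚ :+ n) :* ((con 1ℚ :+ m) :* p :* r :* ((n :- k) :* q :* r) :-
                  (con 1ℚ :+ m) :* ((m :- k) :* p) :* t :* (q :* (((con 1ℚ :+ con 0ℚ) :+ k) :* r))) :=
      (n :- (con 1ℚ :+ m)) :* ((con 1ℚ :+ m) :* (con 1ℚ :+ n)) :* (p :* q :* (((con 1ℚ :+ con 0ℚ) :+ k) :* r :* t)) :+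
      (con 1ℚ :+ n) :* ((con 1ℚ :+ m) :* p :* ((con 1ℚ :+ n) :* q) :* (r :* t))) refl

-- Gaussian rationals and the alternating form `cross`.

record ℚ[i] : Set where
  constructor _+ⁱ_
  field
    re im : ℚ

open ℚ[i]

infixl 6 _⊕_
infixl 7 _⊗_ _•_

_⊕_ _⊗_ : ℚ[i] → ℚ[i] → ℚ[i]
w ⊕ z = (re w + re z) +ⁱ (im w + im z)
w ⊗ z = (re w * re z - im w * im z) +ⁱ (re w * im z + im w * re z)

_•_ : ℚ → ℚ[i] → ℚ[i]
q • z = (q * re z) +ⁱ (q * im z)

norm : ℚ[i] → ℚ
norm z = re z * re z + im z * im z

-- The imaginary part of w times the conjugate of z.
cross : ℚ[i] → ℚ[i] → ℚ
cross w z = im w * re z - re w * im z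

norm-nonNeg : ∀ z → 0ℚ ≤ norm z
norm-nonNeg z = +-nonNeg (square-nonNeg (re z)) (square-nonNeg (im z))

cross-self : ∀ z → cross z z ≡ 0ℚ
cross-self (a +ⁱ b) = solve 2 (λ a b → b :* a :- a :* b := con 0ℚ) refl a b

cross-•ˡ : ∀ q w z → cross (q • w) z ≡ q * cross w z
cross-•ˡ q (a +ⁱ b) (c +ⁱ d) =
  solve 5 (λ q a b c d → q :* b :* c :- q :* a :* d := q :* (b :* c :- a :* d)) refl q a b c d

cross-•ʳ : ∀ q w z → cross w (q • z) ≡ q * cross w z
cross-•ʳ q (a +ⁱ b) (c +ⁱ d) =
  solve 5 (λ q a b c d → b :* (q :* c) :- a :* (q :* d) := q :* (b :* c :- a :* d)) refl q a b c d

cross-⊕ˡ : ∀ v w z → cross (v ⊕ w) z ≡ cross v z + cross w z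
cross-⊕ˡ (a +ⁱ b) (c +ⁱ d) (e +ⁱ f) =
  solve 6 (λ a b c d e f → (b :+ d) :* e :- (a :+ c) :* f :=
    (b :* e :- a :* f) :+ (d :* e :- c :* f)) refl a b c d e f

cross-⊕ʳ : ∀ v w z → cross v (w ⊕ z) ≡ cross v w + cross v z
cross-⊕ʳ (a +ⁱ b) (c +ⁱ d) (e +ⁱ f) =
  solve 6 (λ a b c d e f → b :* (c :+ e) :- a :* (d :+ f) :=
    (b :* c :- a :* d) :+ (b :* e :- a :* f)) refl a b c d e f

-- `cross` is bilinear and alternating. This is how every multiple of X gets removed from F, S and N
-- when paired with X.
cross-shear : ∀ q w z → cross w (q • w ⊕ z) ≡ cross w z
cross-shear q w z = begin
  cross w (q • w ⊕ z)           ≡⟨ cross-⊕ʳ w (q • w) z ⟩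
  cross w (q • w) + cross w z
    ≡⟨ cong (_+ cross w z) (trans (cross-•ʳ q w w) (cong (q *_) (cross-self w))) ⟩
  q * 0ℚ + cross w z            ≡⟨ cong (_+ cross w z) (*-zeroʳ q) ⟩
  0ℚ + cross w z                ≡⟨ +-identityˡ (cross w z) ⟩
  cross w z                     ∎
  where open ≡-Reasoning

cross-⊗-self : ∀ z w → cross (z ⊗ w) w ≡ im z * norm w
cross-⊗-self (x +ⁱ y) (a +ⁱ b) =
  solve 4 (λ x y a b → (x :* b :+ y :* a) :* a :- (x :* a :- y :* b) :* b :=
    y :* (a :* a :+ b :* b)) refl x y a b

cross-⊗-⊗ : ∀ z v w → cross (z ⊗ v) (z ⊗ w) ≡ norm z * cross v w
cross-⊗-⊗ (x +ⁱ y) (a +ⁱ b) (c +ⁱ d) =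
  solve 6 (λ x y a b c d →
    (x :* b :+ y :* a) :* (x :* c :- y :* d) :- (x :* a :- y :* b) :* (x :* d :+ y :* c)
      := (x :* x :+ y :* y) :* (b :* c :- a :* d)) refl x y a b c d

-- Since s² = 1, the difference of the two sides is the squared modulus of z + s i w.
cross≤norms : ∀ s w z → s * s ≡ 1ℚ → s * cross w z + s * cross w z ≤ norm w + norm z
cross≤norms s w@(a +ⁱ b) z@(c +ⁱ d) s²≡1 =
  ≤-by-difference ((c - s * b) * (c - s * b) + (d + s * a) * (d + s * a))
    (+-nonNeg (square-nonNeg (c - s * b)) (square-nonNeg (d + s * a)))
    (trans (expand s a b c d)
      (trans (cong (λ t → t * (a * a + b * b) + (c * c + d * d)) s²≡1)
        (cong (_+ norm z) (*-identityˡ (norm w)))))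
  where
  expand : ∀ s a b c d →
    (s * (b * c - a * d) + s * (b * c - a * d)) + ((c - s * b) * (c - s * b) + (d + s * a) * (d + s * a)) ≡
    (s * s) * (a * a + b * b) + (c * c + d * d)
  expand = solve 5 (λ s a b c d →
    (s :* (b :* c :- a :* d) :+ s :* (b :* c :- a :* d)) :+ ((c :- s :* b) :* (c :- s :* b) :+ (d :+ s :* a) :* (d :+ s :* a)) :=
    (s :* s) :* (a :* a :+ b :* b) :+ (c :* c :+ d :* d)) refl

•-identity : ∀ z → 1ℚ • z ≡ z
•-identity z = cong₂ _+ⁱ_ (*-identityˡ (re z)) (*-identityˡ (im z))

⊗-comm : ∀ w z → w ⊗ z ≡ z ⊗ w
⊗-comm (a +ⁱ b) (c +ⁱ d) = cong₂ _+ⁱ_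
  (solve 4 (λ a b c d → a :* c :- b :* d := c :* a :- d :* b) refl a b c d)
  (solve 4 (λ a b c d → a :* d :+ b :* c := c :* b :+ d :* a) refl a b c d)

⊗-distribˡ-⊕ : ∀ z v w → z ⊗ (v ⊕ w) ≡ z ⊗ v ⊕ z ⊗ w
⊗-distribˡ-⊕ (x +ⁱ y) (a +ⁱ b) (c +ⁱ d) = cong₂ _+ⁱ_
  (solve 6 (λ x y a b c d → x :* (a :+ c) :- y :* (b :+ d) :=
    (x :* a :- y :* b) :+ (x :* c :- y :* d)) refl x y a b c d)
  (solve 6 (λ x y a b c d → x :* (b :+ d) :+ y :* (a :+ c) :=
    (x :* b :+ y :* a) :+ (x :* d :+ y :* c)) refl x y a b c d)

⊗-• : ∀ z q w → z ⊗ (q • w) ≡ q • (z ⊗ w)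
⊗-• (x +ⁱ y) q (a +ⁱ b) = cong₂ _+ⁱ_
  (solve 5 (λ x y q a b → x :* (q :* a) :- y :* (q :* b) := q :* (x :* a :- y :* b)) refl x y q a b)
  (solve 5 (λ x y q a b → x :* (q :* b) :+ y :* (q :* a) := q :* (x :* b :+ y :* a)) refl x y q a b)

⊗-assoc : ∀ v w z → (v ⊗ w) ⊗ z ≡ v ⊗ (w ⊗ z)
⊗-assoc (a +ⁱ b) (c +ⁱ d) (e +ⁱ f) = cong₂ _+ⁱ_
  (solve 6 (λ a b c d e f → (a :* c :- b :* d) :* e :- (a :* d :+ b :* c) :* f
     := a :* (c :* e :- d :* f) :- b :* (c :* f :+ d :* e)) refl a b c d e f)
  (solve 6 (λ a b c d e f → (a :* c :- b :* d) :* f :+ (a :* d :+ b :* c) :* e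
     := a :* (c :* f :+ d :* e) :+ b :* (c :* e :- d :* f)) refl a b c d e f)

⊗-zeroʳ : ∀ z → z ⊗ (0ℚ +ⁱ 0ℚ) ≡ 0ℚ +ⁱ 0ℚ
⊗-zeroʳ (x +ⁱ y) = cong₂ _+ⁱ_
  (solve 2 (λ x y → x :* con 0ℚ :- y :* con 0ℚ := con 0ℚ) refl x y)
  (solve 2 (λ x y → x :* con 0ℚ :+ y :* con 0ℚ := con 0ℚ) refl x y)

⊗-identityˡ : ∀ z → (1ℚ +ⁱ 0ℚ) ⊗ z ≡ z
⊗-identityˡ (x +ⁱ y) = cong₂ _+ⁱ_
  (solve 2 (λ x y → con 1ℚ :* x :- con 0ℚ :* y := x) refl x y)
  (solve 2 (λ x y → con 1ℚ :* y :+ con 0ℚ :* x := y) refl x y)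

-- Evaluation by Horner's rule at Gaussian rationals.

evalℚ : ℕ → (ℕ → ℚ) → ℚ[i] → ℚ[i]
evalℚ zero    c z = 0ℚ +ⁱ 0ℚ
evalℚ (suc d) c z = (c 0 +ⁱ 0ℚ) ⊕ z ⊗ evalℚ d (c ∘ suc) z

evalℚ-cong : ∀ d {b c} z → (∀ k → b k ≡ c k) → evalℚ d b z ≡ evalℚ d c z
evalℚ-cong zero    z b≗c = refl
evalℚ-cong (suc d) z b≗c =
  cong₂ (λ p w → (p +ⁱ 0ℚ) ⊕ z ⊗ w) (b≗c 0) (evalℚ-cong d z (b≗c ∘ suc))

evalℚ-zero : ∀ d z → evalℚ d (λ _ → 0ℚ) z ≡ 0ℚ +ⁱ 0ℚ
evalℚ-zero zero    z = refl
evalℚ-zero (suc d) z = trans (cong (λ w → (0ℚ +ⁱ 0ℚ) ⊕ z ⊗ w) (evalℚ-zero d z))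
  (cong ((0ℚ +ⁱ 0ℚ) ⊕_) (⊗-zeroʳ z))

evalℚ-constant : ∀ d c z → (∀ k → c (suc k) ≡ 0ℚ) → evalℚ (suc d) c z ≡ c 0 +ⁱ 0ℚ
evalℚ-constant d c z c≗0 = begin
  (c 0 +ⁱ 0ℚ) ⊕ z ⊗ evalℚ d (c ∘ suc) z
    ≡⟨ cong (λ w → (c 0 +ⁱ 0ℚ) ⊕ z ⊗ w) (trans (evalℚ-cong d z c≗0) (evalℚ-zero d z)) ⟩
  (c 0 +ⁱ 0ℚ) ⊕ z ⊗ (0ℚ +ⁱ 0ℚ)              ≡⟨ cong ((c 0 +ⁱ 0ℚ) ⊕_) (⊗-zeroʳ z) ⟩
  (c 0 +ⁱ 0ℚ) ⊕ (0ℚ +ⁱ 0ℚ)                  ≡⟨ cong (_+ⁱ 0ℚ) (+-identityʳ (c 0)) ⟩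
  c 0 +ⁱ 0ℚ                                 ∎
  where open ≡-Reasoning

evalℚ-snoc : ∀ d c z → c d ≡ 0ℚ → evalℚ (suc d) c z ≡ evalℚ d c z
evalℚ-snoc zero    c z c≡0 = trans (cong (λ p → (p +ⁱ 0ℚ) ⊕ z ⊗ (0ℚ +ⁱ 0ℚ)) c≡0)
  (cong ((0ℚ +ⁱ 0ℚ) ⊕_) (⊗-zeroʳ z))
evalℚ-snoc (suc d) c z c≡0 = cong (λ w → (c 0 +ⁱ 0ℚ) ⊕ z ⊗ w) (evalℚ-snoc d (c ∘ suc) z c≡0)

•-distribˡ-⊕ : ∀ q w z → q • (w ⊕ z) ≡ q • w ⊕ q • z
•-distribˡ-⊕ q w z = cong₂ _+ⁱ_ (*-distribˡ-+ q (re w) (re z)) (*-distribˡ-+ q (im w) (im z))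

evalℚ-scale : ∀ d c q z → evalℚ d (λ k → q * c k) z ≡ q • evalℚ d c z
evalℚ-scale zero    c q z = cong₂ _+ⁱ_ (sym (*-zeroʳ q)) (sym (*-zeroʳ q))
evalℚ-scale (suc d) c q z = begin
  ((q * c 0) +ⁱ 0ℚ) ⊕ z ⊗ evalℚ d (λ k → q * c (suc k)) z
    ≡⟨ cong₂ (λ p w → ((q * c 0) +ⁱ p) ⊕ z ⊗ w) (sym (*-zeroʳ q)) (evalℚ-scale d (c ∘ suc) q z) ⟩
  q • (c 0 +ⁱ 0ℚ) ⊕ z ⊗ (q • E)
    ≡⟨ cong (q • (c 0 +ⁱ 0ℚ) ⊕_) (⊗-• z q E) ⟩
  q • (c 0 +ⁱ 0ℚ) ⊕ q • (z ⊗ E)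
    ≡⟨ •-distribˡ-⊕ q (c 0 +ⁱ 0ℚ) (z ⊗ E) ⟨
  q • ((c 0 +ⁱ 0ℚ) ⊕ z ⊗ E) ∎
  where
  open ≡-Reasoning
  E = evalℚ d (c ∘ suc) z

evalℚ-linear : ∀ d {b c e} p q z → (∀ k → e k ≡ p * b k + q * c k) →
  evalℚ d e z ≡ p • evalℚ d b z ⊕ q • evalℚ d c z
evalℚ-linear zero p q z h = cong₂ _+ⁱ_ (vanish p q) (vanish p q)
  where
  vanish : ∀ p q → 0ℚ ≡ p * 0ℚ + q * 0ℚ
  vanish = solve 2 (λ p q → con 0ℚ := p :* con 0ℚ :+ q :* con 0ℚ) refl
evalℚ-linear (suc d) {b} {c} {e} p q z h
  rewrite h 0 | evalℚ-linear d p q z (h ∘ suc)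
  = cong₂ _+ⁱ_
     (solve 10 (λ p q b₀ c₀ x y r s t u →
        (p :* b₀ :+ q :* c₀) :+ (x :* (p :* r :+ q :* t) :- y :* (p :* s :+ q :* u)) :=
        p :* (b₀ :+ (x :* r :- y :* s)) :+ q :* (c₀ :+ (x :* t :- y :* u))) refl
        p q (b 0) (c 0) (re z) (im z) (re B) (im B) (re C) (im C))
     (solve 8 (λ p q x y r s t u →
        con 0ℚ :+ (x :* (p :* s :+ q :* u) :+ y :* (p :* r :+ q :* t)) :=
        p :* (con 0ℚ :+ (x :* s :+ y :* r)) :+ q :* (con 0ℚ :+ (x :* u :+ y :* t))) refl
        p q (re z) (im z) (re B) (im B) (re C) (im C))
  where
  B = evalℚ d (b ∘ suc) z
  C = evalℚ d (c ∘ suc) z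

-- Shifting coefficients by one index multiplies the value by z, so a coefficientwise contiguous
-- relation becomes one between values.
evalℚ-shift : ∀ d b c e p q z → e 0 ≡ q * c 0 → (∀ k → e (suc k) ≡ p * b k + q * c (suc k)) →
  evalℚ (suc d) e z ≡ p • (z ⊗ evalℚ d b z) ⊕ q • evalℚ (suc d) c z
evalℚ-shift d b c e p q z h₀ h
  rewrite h₀ | evalℚ-linear d p q z h
  = cong₂ _+ⁱ_
     (solve 9 (λ p q c₀ x y r s t u →
        q :* c₀ :+ (x :* (p :* r :+ q :* t) :- y :* (p :* s :+ q :* u)) :=
        p :* (x :* r :- y :* s) :+ q :* (c₀ :+ (x :* t :- y :* u))) refl
        p q (c 0) (re z) (im z) (re B) (im B) (re C) (im C))
     (solve 8 (λ p q x y r s t u →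
        con 0ℚ :+ (x :* (p :* s :+ q :* u) :+ y :* (p :* r :+ q :* t)) :=
        p :* (x :* s :+ y :* r) :+ q :* (con 0ℚ :+ (x :* u :+ y :* t))) refl
        p q (re z) (im z) (re B) (im B) (re C) (im C))
  where
  B = evalℚ d b z
  C = evalℚ d (c ∘ suc) z

-- Since m < d, the coefficient of index d in the last polynomial vanishes; dropping it leaves both
-- polynomials on the right with the same length d.
evalℚ-raise₁ : ∀ {d} j m n z → m ℕ.< d → evalℚ (suc d) (coeff j (suc m) n) z ≡
  (ι n - ι m) • (z ⊗ evalℚ d (coeff (suc j) m n) z) ⊕ evalℚ d (coeff j m (suc n)) z
evalℚ-raise₁ {d} j m n z m<d = trans
  (evalℚ-shift d (coeff (suc j) m n) (coeff j m (suc n)) (coeff j (suc m) n) (ι n - ι m) 1ℚ z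
    -- As `falling _ 0` is 1, the constant coefficient computes to the same value for all m and n.
    (sym (*-identityˡ (coeff j m n 0))) (coeff-raise₁ j m n))
  (cong (λ w → (ι n - ι m) • (z ⊗ evalℚ d (coeff (suc j) m n) z) ⊕ w)
    (trans (•-identity _) (evalℚ-snoc d (coeff j m (suc n)) z (coeff-vanishes j (suc n) {d} m<d))))

evalℚ-raise₂ : ∀ {d} j m n z → m ℕ.< d → evalℚ (suc d) (coeff j (suc m) (suc n)) z ≡
  ι (suc n) • (z ⊗ evalℚ d (coeff (suc j) m n) z) ⊕ evalℚ d (coeff j m (suc n)) z
evalℚ-raise₂ {d} j m n z m<d = trans
  (evalℚ-shift d (coeff (suc j) m n) (coeff j m (suc n)) (coeff j (suc m) (suc n)) (ι (suc n)) 1ℚ z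
    (sym (*-identityˡ (coeff j m n 0))) (coeff-raise₂ j m n))
  (cong (λ w → ι (suc n) • (z ⊗ evalℚ d (coeff (suc j) m n) z) ⊕ w)
    (trans (•-identity _) (evalℚ-snoc d (coeff j m (suc n)) z (coeff-vanishes j (suc n) {d} m<d))))

evalℚ-lower : ∀ d j m n z → evalℚ (suc d) (coeff j (suc m) (suc n)) z ≡
  (ι (suc m) * (ι (suc n) + ι (suc j))) • (z ⊗ evalℚ d (coeff (suc (suc j)) m n) z) ⊕
  ι (suc j) • evalℚ (suc d) (coeff (suc j) (suc m) n) z
evalℚ-lower d j m n z =
  evalℚ-shift d (coeff (suc (suc j)) m n) (coeff (suc j) (suc m) n) (coeff j (suc m) (suc n))
    (ι (suc m) * (ι (suc n) + ι (suc j))) (ι (suc j)) z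
    (coeff-lower₀ j m n) (coeff-lower j m n)

-- The inductive lower bound for pairs F, G.

module _ (δ ρ κ s : ℚ) (z v w : ℚ[i]) where

  private
    X = z ⊗ v
    F = ρ • X ⊕ w
    G = δ • X ⊕ κ • F

  -- The part κ F of G is killed by F, and against X the polynomial F counts only as w.
  cross-step-G-F : s * cross G F ≡ δ * (s * cross X w)
  cross-step-G-F = begin
    s * cross G F                               ≡⟨ cong (s *_) (cross-⊕ˡ (δ • X) (κ • F) F) ⟩
    s * (cross (δ • X) F + cross (κ • F) F)
      ≡⟨ cong (s *_) (cong₂ _+_ (cross-•ˡ δ X F) (cross-•ˡ κ F F)) ⟩
    s * (δ * cross X F + κ * cross F F)
      ≡⟨ cong (s *_) (cong₂ (λ p q → δ * p + κ * q) (cross-shear ρ X w) (cross-self F)) ⟩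
    s * (δ * cross X w + κ * 0ℚ)                ≡⟨ regroup s δ κ (cross X w) ⟩
    δ * (s * cross X w)                         ∎
    where
    open ≡-Reasoning
    regroup : ∀ s d k c → s * (d * c + k * 0ℚ) ≡ d * (s * c)
    regroup = solve 4 (λ s d k c → s :* (d :* c :+ k :* con 0ℚ) := d :* (s :* c)) refl

  -- Against F, z F yields Im z |F|². Against X = z v, its part ρ z X yields ρ Im z |X|² and its
  -- part z w yields |z|² times `cross w v`.
  cross-step-zF-G : s * cross (z ⊗ F) G ≡
    (s * im z) * (κ * norm F + δ * ρ * norm X) + δ * norm z * (s * cross w v)
  cross-step-zF-G = begin
    s * cross (z ⊗ F) G
      ≡⟨ cong (s *_) (cross-⊕ʳ (z ⊗ F) (δ • X) (κ • F)) ⟩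
    s * (cross (z ⊗ F) (δ • X) + cross (z ⊗ F) (κ • F))
      ≡⟨ cong (s *_) (cong₂ _+_ (cross-•ʳ δ (z ⊗ F) X) (cross-•ʳ κ (z ⊗ F) F)) ⟩
    s * (δ * cross (z ⊗ F) X + κ * cross (z ⊗ F) F)
      ≡⟨ cong (s *_) (cong₂ (λ p q → δ * p + κ * q) cross-zF-X (cross-⊗-self z F)) ⟩
    s * (δ * (ρ * (im z * norm X) + norm z * cross w v) + κ * (im z * norm F))
      ≡⟨ regroup s δ ρ κ (im z) (norm X) (norm F) (norm z) (cross w v) ⟩
    (s * im z) * (κ * norm F + δ * ρ * norm X) + δ * norm z * (s * cross w v) ∎
    where
    open ≡-Reasoning
    cross-zF-X : cross (z ⊗ F) X ≡ ρ * (im z * norm X) + norm z * cross w v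
    cross-zF-X = begin
      cross (z ⊗ F) X
        ≡⟨ cong (λ t → cross t X) (trans (⊗-distribˡ-⊕ z (ρ • X) w) (cong (_⊕ z ⊗ w) (⊗-• z ρ X))) ⟩
      cross (ρ • (z ⊗ X) ⊕ z ⊗ w) X             ≡⟨ cross-⊕ˡ (ρ • (z ⊗ X)) (z ⊗ w) X ⟩
      cross (ρ • (z ⊗ X)) X + cross (z ⊗ w) X
        ≡⟨ cong₂ _+_ (trans (cross-•ˡ ρ (z ⊗ X) X) (cong (ρ *_) (cross-⊗-self z X))) (cross-⊗-⊗ z w v) ⟩
      ρ * (im z * norm X) + norm z * cross w v  ∎
    regroup : ∀ s d r k y a b c e →
      s * (d * (r * (y * a) + c * e) + k * (y * b)) ≡ (s * y) * (k * b + d * r * a) + d * c * (s * e)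
    regroup = solve 9 (λ s d r k y a b c e →
      s :* (d :* (r :* (y :* a) :+ c :* e) :+ k :* (y :* b)) :=
        (s :* y) :* (k :* b :+ d :* r :* a) :+ d :* c :* (s :* e)) refl

  -- The bound on `cross X w` is also one on `cross X F`, which keeps |F|² + |X|² away from 0. These
  -- squares enter `cross-step-zF-G` with weights at least 1 and the factor s Im z ≥ ε; the
  -- remaining term is nonnegative.
  cross-step-bound : ∀ {ε c} → 0ℚ ≤ ε → 0ℚ ≤ c → s * s ≡ 1ℚ → ε ≤ s * im z →
    1ℚ ≤ κ → 1ℚ ≤ ρ → 1ℚ ≤ δ → c ≤ s * cross X w → 0ℚ ≤ s * cross w v →
    ε * c ≤ s * cross (z ⊗ F) G × 0ℚ ≤ s * cross G F
  cross-step-bound {ε} {c} 0≤ε 0≤c s²≡1 ε≤y 1≤κ 1≤ρ 1≤δ c≤ 0≤ = lower , upper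
    where
    open ≤-Reasoning
    0≤δ : 0ℚ ≤ δ
    0≤δ = ≤-trans 0≤1 1≤δ
    1≤δρ : 1ℚ ≤ δ * ρ
    1≤δρ = *-mono-≤-nonNeg 0≤1 0≤1 1≤δ 1≤ρ
    scale : ∀ {q} x → 0ℚ ≤ x → 1ℚ ≤ q → x ≤ q * x
    scale {q} x 0≤x 1≤q = subst (_≤ q * x) (*-identityˡ x)
      (*-monoʳ-≤-nonNeg x {{nonNegative 0≤x}} 1≤q)
    c≤norms : c ≤ norm F + norm X
    c≤norms = begin
      -- The doubling matches the factor 2 in `cross≤norms`, which is then given away.
      c                                 ≤⟨ ≤-by-difference c 0≤c refl ⟩
      c + c                             ≤⟨ +-mono-≤ c≤ c≤ ⟩
      s * cross X w + s * cross X w     ≡⟨ cong (λ t → s * t + s * t) (cross-shear ρ X w) ⟨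
      s * cross X F + s * cross X F     ≤⟨ cross≤norms s X F s²≡1 ⟩
      norm X + norm F                   ≡⟨ +-comm (norm X) (norm F) ⟩
      norm F + norm X                   ∎
    lower : ε * c ≤ s * cross (z ⊗ F) G
    lower = begin
      ε * c
        ≤⟨ *-mono-≤-nonNeg 0≤ε 0≤c ε≤y (≤-trans c≤norms
             (+-mono-≤ (scale (norm F) (norm-nonNeg F) 1≤κ) (scale (norm X) (norm-nonNeg X) 1≤δρ))) ⟩
      (s * im z) * (κ * norm F + δ * ρ * norm X)
        ≤⟨ ≤-by-difference (δ * norm z * (s * cross w v)) (*-nonNeg (*-nonNeg 0≤δ (norm-nonNeg z)) 0≤) refl ⟩
      (s * im z) * (κ * norm F + δ * ρ * norm X) + δ * norm z * (s * cross w v)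
        ≡⟨ cross-step-zF-G ⟨
      s * cross (z ⊗ F) G ∎
    upper : 0ℚ ≤ s * cross G F
    upper = subst (0ℚ ≤_) (sym cross-step-G-F) (*-nonNeg 0≤δ (≤-trans 0≤c c≤))

-- The constant c is chosen before z, s and d, so one bound serves all terms of a Cauchy sequence.
-- The second inequality is carried along because the next step uses it for the first. The
-- hypothesis m ≤ n ensures ρ ≥ 1.
cross-bound : ∀ m n → m ℕ.≤ n → ∀ j ε → Positive ε → ∃[ c ] Positive c ×
  (∀ d → m ℕ.< d → ∀ s z → s * s ≡ 1ℚ → ε ≤ s * im z →
    let F = evalℚ d (coeff (suc j) m n) z
        G = evalℚ d (coeff j m (suc n)) z
    in c ≤ s * cross (z ⊗ F) G × 0ℚ ≤ s * cross G F)
-- For m = 0 both F and G are positive constants p and q, so the first form is s Im z p q and the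
-- second is 0.
cross-bound zero n _ j ε ε>0 = ε * (p * q)
  , pos*pos⇒pos ε {{ε>0}} (p * q) {{pq>0}}
  , λ { (suc d) _ s z s²≡1 ε≤y → bound d s z ε≤y }
  where
  p = coeff (suc j) 0 n 0
  q = coeff j 0 (suc n) 0
  pq>0 : Positive (p * q)
  pq>0 = pos*pos⇒pos p {{coeff₀-positive (suc j) 0 n}} q {{coeff₀-positive j 0 (suc n)}}
  identity₁ : ∀ s x y p q →
    (s * y) * (p * q) ≡ s * ((x * 0ℚ + y * p) * q - (x * p - y * 0ℚ) * 0ℚ)
  identity₁ = solve 5 (λ s x y p q →
    (s :* y) :* (p :* q) :=
      s :* ((x :* con 0ℚ :+ y :* p) :* q :- (x :* p :- y :* con 0ℚ) :* con 0ℚ)) refl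
  identity₂ : ∀ s p q → 0ℚ ≡ s * (0ℚ * p - q * 0ℚ)
  identity₂ = solve 3 (λ s p q → con 0ℚ := s :* (con 0ℚ :* p :- q :* con 0ℚ)) refl
  bound : ∀ d s z → ε ≤ s * im z →
    let F = evalℚ (suc d) (coeff (suc j) 0 n) z
        G = evalℚ (suc d) (coeff j 0 (suc n)) z
    in ε * (p * q) ≤ s * cross (z ⊗ F) G × 0ℚ ≤ s * cross G F
  bound d s z ε≤y = subst₂ (λ F G → ε * (p * q) ≤ s * cross (z ⊗ F) G × 0ℚ ≤ s * cross G F)
    (sym (evalℚ-constant d (coeff (suc j) 0 n) z (λ k → coeff-vanishes (suc j) n {suc k} (s≤s z≤n))))
    (sym (evalℚ-constant d (coeff j 0 (suc n)) z (λ k → coeff-vanishes j (suc n) {suc k} (s≤s z≤n))))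
    ( ≤-trans (*-monoʳ-≤-nonNeg (p * q) {{pos⇒nonNeg (p * q) {{pq>0}}}} ε≤y)
        (≤-reflexive (identity₁ s (re z) (im z) p q))
    , ≤-reflexive (identity₂ s p q))
-- The pair for `suc m` and j arises from the pair for m and `suc j`, at the same z; each step costs
-- one factor ε.
cross-bound (suc m) n m<n j ε ε>0 with cross-bound m n (ℕ.<⇒≤ m<n) (suc j) ε ε>0
... | c , c>0 , ih = ε * c , pos*pos⇒pos ε {{ε>0}} c {{c>0}} , bound
  where
  δ = ι (suc m) * (ι (suc n) + ι (suc j))
  ρ = ι n - ι m
  κ = ι (suc j)
  1≤ρ : 1ℚ ≤ ρ
  1≤ρ = subst (_≤ ρ) (identity (ι m)) (+-monoˡ-≤ (- ι m) (ι-mono-≤ m<n))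
    where
    identity : ∀ p → (1ℚ + p) - p ≡ 1ℚ
    identity = solve 1 (λ p → (con 1ℚ :+ p) :- p := con 1ℚ) refl
  1≤δ : 1ℚ ≤ δ
  1≤δ = *-mono-≤-nonNeg 0≤1 0≤1 (1≤ι-suc m)
    (≤-trans (1≤ι-suc n) (≤-by-difference (ι (suc j)) (0≤ι (suc j)) refl))
  bound : ∀ d → suc m ℕ.< d → ∀ s z → s * s ≡ 1ℚ → ε ≤ s * im z →
    let F = evalℚ d (coeff (suc j) (suc m) n) z
        G = evalℚ d (coeff j (suc m) (suc n)) z
    in ε * c ≤ s * cross (z ⊗ F) G × 0ℚ ≤ s * cross G F
  bound (suc d) (s≤s m<d) s z s²≡1 ε≤y =
    subst₂ (λ F G → ε * c ≤ s * cross (z ⊗ F) G × 0ℚ ≤ s * cross G F)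
      (sym F≡) (sym (trans (evalℚ-lower d j m n z) (cong (λ F → δ • (z ⊗ v) ⊕ κ • F) F≡)))
      (let c≤ , 0≤ = ih d m<d s z s²≡1 ε≤y in
       cross-step-bound δ ρ κ s z v w
         (<⇒≤ (positive⁻¹ ε {{ε>0}})) (<⇒≤ (positive⁻¹ c {{c>0}})) s²≡1 ε≤y
         (1≤ι-suc j) 1≤ρ 1≤δ c≤ 0≤)
    where
    v = evalℚ d (coeff (suc (suc j)) m n) z
    w = evalℚ d (coeff (suc j) m (suc n)) z
    F≡ : evalℚ (suc d) (coeff (suc j) (suc m) n) z ≡ ρ • (z ⊗ v) ⊕ w
    F≡ = evalℚ-raise₁ (suc j) m n z m<d

-- Rational null sequences.

Null : (ℕ → ℚ) → Set
Null f = ∀ ε → Positive ε → ∃[ N ] (∀ n → N ℕ.≤ n → ∣ f n ∣ < ε)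

null-cong : ∀ {f g} → (∀ n → f n ≡ g n) → Null f → Null g
null-cong f≗g f→0 ε ε>0 with f→0 ε ε>0
... | N , small = N , λ n n≥ → subst (λ t → ∣ t ∣ < ε) (f≗g n) (small n n≥)

null-+ : ∀ {f g} → Null f → Null g → Null (λ n → f n + g n)
null-+ {f} {g} f→0 g→0 ε ε>0
  with f→0 (½ * ε) (half-pos ε ε>0) | g→0 (½ * ε) (half-pos ε ε>0)
... | M , f< | N , g< = M ℕ.⊔ N , λ n n≥ → begin-strict
  ∣ f n + g n ∣       ≤⟨ ∣p+q∣≤∣p∣+∣q∣ (f n) (g n) ⟩
  ∣ f n ∣ + ∣ g n ∣   <⟨ +-mono-< (f< n (ℕ.m⊔n≤o⇒m≤o M N n≥)) (g< n (ℕ.m⊔n≤o⇒n≤o M N n≥)) ⟩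
  ½ * ε + ½ * ε       ≡⟨ halves ε ⟩
  ε                   ∎
  where open ≤-Reasoning

null-neg : ∀ {f} → Null f → Null (λ n → - f n)
null-neg {f} f→0 ε ε>0 with f→0 ε ε>0
... | N , small = N , λ n n≥ → subst (_< ε) (sym (∣-p∣≡∣p∣ (f n))) (small n n≥)

null-* : ∀ {f g} → Null f → IsCauchy g → Null (λ n → f n * g n)
null-* {f} {g} f→0 cg ε ε>0
  with bounded g cg
... | B , B>0 , M , g≤B with tolerance B B>0 ε ε>0
... | δ , δ>0 , Bδ≡ with f→0 δ δ>0
... | N , small = M ℕ.⊔ N , λ n n≥ → begin-strict
  ∣ f n * g n ∣   ≡⟨ cong ∣_∣ (*-comm (f n) (g n)) ⟩
  ∣ g n * f n ∣   <⟨ ∣*∣-bound B>0 (g n) (f n) (g≤B n (ℕ.m⊔n≤o⇒m≤o M N n≥)) (small n (ℕ.m⊔n≤o⇒n≤o M N n≥)) ⟩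
  B * δ           ≡⟨ Bδ≡ ⟩
  -- `tolerance` is tuned to half of ε, which is more than enough here.
  ½ * ε           ≤⟨ ≤-by-difference (½ * ε) (<⇒≤ (positive⁻¹ (½ * ε) {{half-pos ε ε>0}})) (halves ε) ⟩
  ε               ∎
  where open ≤-Reasoning

≃0⇒null : ∀ x → x ≃ 0ᵣ → Null (seq x)
≃0⇒null x = null-cong {λ n → seq x n - 0ℚ} (λ n → +-identityʳ (seq x n))

null⇒≃0 : ∀ x → Null (seq x) → x ≃ 0ᵣ
null⇒≃0 x = null-cong (λ n → sym (+-identityʳ (seq x n)))

-- Whether ε ≤ ∣ f n ∣ is decidable because f n is rational, so f → 0 may be
-- proved by refuting ε ≤ ± f n for large n.
null-by-lower-bound : ∀ {f g} → Null g →
  (∀ ε → Positive ε → ∃[ c ] Positive c ×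
    (∀ n s → s * s ≡ 1ℚ → ε ≤ s * f n → c ≤ s * g n)) →
  Null f
null-by-lower-bound {f} {g} g→0 lower ε ε>0 with lower ε ε>0
... | c , c>0 , c≤ with g→0 c c>0
... | N , g< = N , λ n n≥ → ≰⇒> (λ ε≤∣f∣ → impossible n (g< n n≥) ε≤∣f∣)
  where
  contradict : ∀ s n → ∣ s ∣ ≡ 1ℚ → s * s ≡ 1ℚ → ∣ g n ∣ < c → ¬ (ε ≤ s * f n)
  contradict s n ∣s∣≡1 s²≡1 g<c ε≤ = <-irrefl refl (begin-strict
    c                ≤⟨ c≤ n s s²≡1 ε≤ ⟩
    s * g n          ≤⟨ p≤∣p∣ (s * g n) ⟩
    ∣ s * g n ∣      ≡⟨ ∣p*q∣≡∣p∣*∣q∣ s (g n) ⟩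
    ∣ s ∣ * ∣ g n ∣  ≡⟨ cong (_* ∣ g n ∣) ∣s∣≡1 ⟩
    1ℚ * ∣ g n ∣     ≡⟨ *-identityˡ ∣ g n ∣ ⟩
    ∣ g n ∣          <⟨ g<c ⟩
    c                ∎)
    where open ≤-Reasoning
  impossible : ∀ n → ∣ g n ∣ < c → ¬ (ε ≤ ∣ f n ∣)
  impossible n g<c ε≤ with ∣p∣≡p∨∣p∣≡-p (f n)
  ... | inj₁ eq = contradict 1ℚ n refl refl g<c
    (subst (ε ≤_) (trans eq (sym (*-identityˡ (f n)))) ε≤)
  ... | inj₂ eq = contradict (- 1ℚ) n refl refl g<c
    (subst (ε ≤_) (trans eq (-≡-1* (f n))) ε≤)
    where
    -≡-1* : ∀ p → - p ≡ - 1ℚ * p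
    -≡-1* = solve 1 (λ p → :- p := con (- 1ℚ) :* p) refl

-- Termwise evaluation of complex polynomials.

sample : ℂ → ℕ → ℚ[i]
sample z t = seq (Re z) t +ⁱ seq (Im z) t

fromCoefficients : ∀ d → (ℕ → ℚ) → Polynomial d
fromCoefficients d c k = fromℚ (c (toℕ k))

-- Reconciles a sum over powers with Horner's rule. The induction replaces `power` by `power ∘ suc`,
-- so the claim is made for any geometric sequence and keeps its first term as a factor.
sample-sum : ∀ d c (power : ℕ → ℂ) z t →
  (∀ k → sample (power (suc k)) t ≡ sample (power k) t ⊗ z) →
  sample (sumᶜ {d} λ k → fromℝ (fromCoefficients d c k) *ᶜ power (toℕ k)) t ≡
  sample (power 0) t ⊗ evalℚ d c z
sample-sum zero    c power z t geometric = sym (⊗-zeroʳ (sample (power 0) t))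
sample-sum (suc d) c power z t geometric = begin
  ((c 0 +ⁱ 0ℚ) ⊗ w) ⊕ sample (sumᶜ {d} λ k → fromℝ (fromCoefficients d (c ∘ suc) k) *ᶜ power (suc (toℕ k))) t
    ≡⟨ cong (((c 0 +ⁱ 0ℚ) ⊗ w) ⊕_) (sample-sum d (c ∘ suc) (power ∘ suc) z t (geometric ∘ suc)) ⟩
  ((c 0 +ⁱ 0ℚ) ⊗ w) ⊕ sample (power 1) t ⊗ E
    ≡⟨ cong₂ _⊕_ (⊗-comm (c 0 +ⁱ 0ℚ) w) (trans (cong (_⊗ E) (geometric 0)) (⊗-assoc w z E)) ⟩
  w ⊗ (c 0 +ⁱ 0ℚ) ⊕ w ⊗ (z ⊗ E)
    ≡⟨ ⊗-distribˡ-⊕ w (c 0 +ⁱ 0ℚ) (z ⊗ E) ⟨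
  w ⊗ ((c 0 +ⁱ 0ℚ) ⊕ z ⊗ E) ∎
  where
  open ≡-Reasoning
  w = sample (power 0) t
  E = evalℚ d (c ∘ suc) z

sample-eval : ∀ d c z t → sample (eval (fromCoefficients d c) z) t ≡ evalℚ d c (sample z t)
sample-eval d c z t = trans
  (sample-sum d c (z ^ᶜ_) (sample z t) t (λ k → ⊗-comm (sample z t) (sample (z ^ᶜ k) t)))
  (⊗-identityˡ (evalℚ d c (sample z t)))

null-cross : ∀ w z → w ≈ᶜ 0ᶜ → Null (λ t → cross (sample z t) (sample w t))
null-cross w z (Re≃0 , Im≃0) =
  null-cong {λ t → seq (Re w) t * seq (Im z) t + - (seq (Im w) t * seq (Re z) t)}
    (λ t → cong₂ _-_ (*-comm (seq (Re w) t) (seq (Im z) t)) (*-comm (seq (Im w) t) (seq (Re z) t)))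
    (null-+ (null-* (≃0⇒null (Re w) Re≃0) (cauchy (Im z)))
            (null-neg (null-* (≃0⇒null (Im w) Im≃0) (cauchy (Re z)))))

-- From the uniform bound to real zeros.

module _ {d : ℕ} (m n : ℕ) (c : ℕ → ℚ) (p q : ℚ) (q>0 : Positive q)
  (m≤n : m ℕ.≤ n) (m<d : m ℕ.< d)
  (c₀ : c 0 ≡ coeff 1 (suc m) (suc n) 0)
  (c₊ : ∀ k → q * c (suc k) ≡ p * coeff 2 m n k + q * coeff 1 (suc m) (suc n) (suc k))
  where

  -- The hypotheses on `c` say that q times its polynomial is p X + q S, and S = (n+1) X + Y.
  -- `cross-shear` removes both multiples of X, whatever the sign of p.
  cross-evalℚ : ∀ z → let X = z ⊗ evalℚ d (coeff 2 m n) z in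
    cross X (evalℚ (suc d) c z) ≡ cross X (evalℚ d (coeff 1 m (suc n)) z)
  cross-evalℚ z = *-cancelˡ-pos q q>0 (begin
    q * cross X (evalℚ (suc d) c z)             ≡⟨ cross-•ʳ q X (evalℚ (suc d) c z) ⟨
    cross X (q • evalℚ (suc d) c z)             ≡⟨ cong (cross X) (evalℚ-scale (suc d) c q z) ⟨
    cross X (evalℚ (suc d) (λ k → q * c k) z)
      ≡⟨ cong (cross X) (evalℚ-shift d (coeff 2 m n) (coeff 1 (suc m) (suc n)) (λ k → q * c k) p q z (cong (q *_) c₀) c₊) ⟩
    cross X (p • X ⊕ q • S)                     ≡⟨ cross-shear p X (q • S) ⟩
    cross X (q • S)                             ≡⟨ cross-•ʳ q X S ⟩
    q * cross X S
      ≡⟨ cong (λ t → q * cross X t) (evalℚ-raise₂ 1 m n z m<d) ⟩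
    q * cross X (ι (suc n) • X ⊕ Y)             ≡⟨ cong (q *_) (cross-shear (ι (suc n)) X Y) ⟩
    q * cross X Y                               ∎)
    where
    open ≡-Reasoning
    X = z ⊗ evalℚ d (coeff 2 m n) z
    S = evalℚ (suc d) (coeff 1 (suc m) (suc n)) z
    Y = evalℚ d (coeff 1 m (suc n)) z

  -- The terms approximating a zero need not be zeros themselves, but along them N tends to 0, hence
  -- so does `cross X N`. By `cross-bound` with j = 1 this form stays at distance b from 0 wherever
  -- the imaginary part has modulus at least ε.
  onlyRealZeros : HasOnlyRealZeros (fromCoefficients (suc d) c)
  onlyRealZeros z N≈0 ε ε>0 = null⇒≃0 (Im z) (null-by-lower-bound (null-cross N X N≈0) lower) ε ε>0
    where
    N = eval (fromCoefficients (suc d) c) z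
    X = z *ᶜ eval (fromCoefficients d (coeff 2 m n)) z
    lower : ∀ ε → Positive ε → ∃[ b ] Positive b ×
      (∀ t s → s * s ≡ 1ℚ → ε ≤ s * seq (Im z) t → b ≤ s * cross (sample X t) (sample N t))
    lower ε ε>0 with cross-bound m n m≤n 1 ε ε>0
    ... | b , b>0 , bound = b , b>0 , λ t s s²≡1 ε≤ →
      subst (λ r → b ≤ s * r) (sym (cross-sample t)) (proj₁ (bound d m<d s (sample z t) s²≡1 ε≤))
      where
      cross-sample : ∀ t → cross (sample X t) (sample N t) ≡
        cross (sample z t ⊗ evalℚ d (coeff 2 m n) (sample z t)) (evalℚ d (coeff 1 m (suc n)) (sample z t))
      cross-sample t = trans
        (cong₂ (λ v w → cross (sample z t ⊗ v) w)
          (sample-eval d (coeff 2 m n) z t) (sample-eval (suc d) c z t))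
        (cross-evalℚ (sample z t))

1≉0 : ¬ Null (λ _ → 1ℚ)
1≉0 1→0 with 1→0 1ℚ _
... | N , small = <-irrefl refl (small N ℕ.≤-refl)

corollary4p5 : (m n : ℕ) → HasOnlyRealZeros N[ m , n ]
corollary4p5 zero n z (Re≃0 , _) = ⊥-elim (1≉0 (null-cong (λ t → cong re (constant t)) (≃0⇒null (Re w) Re≃0)))
  where
  c : ℕ → ℚ
  c k = coefficient 0 n (+ k) / 1
  w = eval (fromCoefficients 1 c) z
  -- For m = 0 the polynomial is the constant 1, so the assumed zero is contradictory.
  constant : ∀ t → sample w t ≡ 1ℚ +ⁱ 0ℚ
  constant t = begin
    sample w t                                           ≡⟨ sample-eval 1 c z t ⟩
    (c 0 +ⁱ 0ℚ) ⊕ sample z t ⊗ (0ℚ +ⁱ 0ℚ)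
      ≡⟨ cong₂ (λ p v → (p +ⁱ 0ℚ) ⊕ v) (coefficient₀ 0 n) (⊗-zeroʳ (sample z t)) ⟩
    1ℚ +ⁱ 0ℚ                                             ∎
    where open ≡-Reasoning
corollary4p5 (suc m) n with ℕ.≤-total m n
... | inj₁ m≤n = onlyRealZeros m n (λ k → coefficient (suc m) n (+ k) / 1)
  ((ι n - ι (suc m)) * (ι (suc m) * ι (suc n))) (ι (suc n)) (ι-suc-positive n)
  m≤n (ℕ.n<1+n m) (coefficient₀ (suc m) n) (coefficient-suc m n)
-- As `coeff` is symmetric in its two upper parameters, their roles are exchanged to put the smaller
-- one first. The length still comes from m, which is why d is independent of the smaller parameter.
... | inj₂ n≤m = onlyRealZeros n m (λ k → coefficient (suc m) n (+ k) / 1) p (ι (suc n)) (ι-suc-positive n)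
  n≤m (s≤s n≤m) (coefficient₀ (suc m) n)
  (λ k → trans (coefficient-suc m n k) (cong₂ (λ a b → p * a + ι (suc n) * b) (coeff-comm 2 m n k) (coeff-comm 1 (suc m) (suc n) (suc k))))
  where
  p = (ι n - ι (suc m)) * (ι (suc m) * ι (suc n))
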